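{- Let $\vec{C}_6$ be the directed $6$-cycle and let $\vec{P}_3$ be the directed path with $3$ vertices and $2$ arcs. The Desargues graph $\mathcal D$ is a $\{\vec{C}_6\}_{\vec{P}_3}$-ultrahomogeneous digraph, and the Pappus graph $\mathcal P$ is a $\{\vec{C}_6\}^{\vec{P}_3}$-ultrahomogeneous digraph.
   Context: **The graphs.** The Pappus graph $\mathcal P$ is the cubic graph on vertex set $\mathbb Z_{18}$ obtained from the $18$-cycle $(0,1,\ldots,17)$ by adding the edges $\{1+6x,6+6x\}$, $\{2+6x,9+6x\}$, $\{4+6x,11+6x\}$ for $x\in\{0,1,2\}$ (mod $18$). The Desargues graph $\mathcal D$ is the cubic graph obtained from the $20$-cycle $(0,1,\ldots,19)$, whose vertices $4x,4x+1,4x+2,4x+3$ are renamed $x_0,x_1,x_2,x_3$ respectively ($x\in\mathbb Z_5$), by adding the edges $\{x_3,(x+2)_0\}$ and $\{x_1,(x+2)_2\}$ for $x\in\mathbb Z_5$ (mod $5$). **Conventions.** An undirected graph $G$ is regarded as a digraph in which every edge $\{u,v\}$ is the pair of opposite arcs $(u,v)$ and $(v,u)$; $A(\cdot)$ denotes the arc set. An induced copy of a directed cycle or directed path $\vec H$ in such a $G$ is a subdigraph isomorphic to $\vec H$ whose underlying undirected graph is an induced subgraph of the undirected graph $G$. **Definitions.** $G$ is an $\vec H$-UH (ultrahomogeneous) digraph if every isomorphism between two induced copies of $\vec H$ in $G$ extends to an automorphism of $G$. Let $\vec M$ be a subdigraph of $\vec H$ (here $\vec M=\vec P_3$, $\vec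 H=\vec C_6$) and let $G$ be both $\vec M$-UH and $\vec H$-UH. Then $G$ is an $\{\vec H\}_{\vec M}$-UH digraph (respectively, an $\{\vec H\}^{\vec M}$-UH digraph) if for each induced copy $\vec H_0$ of $\vec H$ in $G$ and each copy $\vec M_0$ of $\vec M$ contained in $\vec H_0$ there exists exactly one induced copy $\vec H_1\neq\vec H_0$ of $\vec H$ in $G$ such that $V(\vec H_0)\cap V(\vec H_1)=V(\vec M_0)$ and $A(\vec H_0)\cap\bar A(\vec H_1)=A(\vec M_0)$ (respectively, $A(\vec H_0)\cap A(\vec H_1)=A(\vec M_0)$), where $\bar A(\vec H_1)=\{(v,u):(u,v)\in A(\vec H_1)\}$ is the set of reversed arcs of $\vec H_1$. -}

module Defs where

open import Data.Fin using (Fin; toℕ; combine)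
open import Data.Fin.Patterns using (0F; 1F; 2F; 3F)
open import Data.Fin.Properties using (all?; _≟_)
open import Data.Nat using (ℕ; suc; NonZero; _+_; _*_)
open import Data.Nat.DivMod using (_mod_)
open import Data.Product using (_×_; _,_; ∃; ∃!; ∃-syntax; proj₁; proj₂)
open import Data.Unit using (tt)
open import Function.Base using (flip)
import Function.Bundles as Fun
open import Level using (0ℓ)
open import Relation.Binary.Bundles using (Setoid)
open import Relation.Binary.Core using (Rel; _⇒_; _⇔_)
open import Relation.Binary.Definitions using (Irreflexive; Symmetric)
import Relation.Binary.Construct.Closure.Symmetric as Sym
open Sym using (SymClosure; fwd; bwd)
open import Relation.Binary.Construct.Intersection using () renaming (_∩_ to _∩ᵣ_)
import Relation.Binary.Construct.On as On
open import Relation.Binary.PropositionalEquality using (_≡_; refl; sym; setoid)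
open import Relation.Nullary.Decidable using (¬?; from-yes)
open import Relation.Nullary.Negation using (¬_)
open import Relation.Unary using (Pred; U; _∩_; _≐_) renaming (_⊆_ to _⊆ₚ_)

-- A digraph whose vertices are drawn from an ambient type X, so that
-- vertex sets and arc sets of subdigraphs can be intersected and compared.
record Digraph (X : Set) : Set₁ where
  field
    V      : Pred X 0ℓ
    A      : Rel X 0ℓ
    A⊆V×V : ∀ {u v} → A u v → V u × V v

  -- Vertices are compared by their underlying element of X; the membership
  -- proof is ignored.
  vertices : Setoid 0ℓ 0ℓ
  vertices = On.setoid {B = ∃ V} (setoid X) proj₁

open Digraph public

private
  variable
    X Y Z : Set

infix 4 _⊆_ _≈_ _≅_

_⊆_ : Rel (Digraph X) 0ℓ
D ⊆ E = (V D ⊆ₚ V E) × (A D ⇒ A E)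

_≈_ : Rel (Digraph X) 0ℓ
D ≈ E = (V D ≐ V E) × (A D ⇔ A E)

record _≅_ (D : Digraph X) (E : Digraph Y) : Set where
  field
    bijection : Fun.Inverse (vertices D) (vertices E)
  open Fun.Inverse bijection public using (to; from)
  field
    arcs : ∀ u v → A D (proj₁ u) (proj₁ v) Fun.⇔ A E (proj₁ (to u)) (proj₁ (to v))

record Graph (X : Set) : Set₁ where
  field
    Edge   : Rel X 0ℓ
    symm   : Symmetric Edge
    irrefl : Irreflexive _≡_ Edge

open Graph public using (Edge)

asDigraph : Graph X → Digraph X
asDigraph G = record { V = U ; A = Edge G ; A⊆V×V = λ _ → tt , tt }

IsCopy : Digraph Y → Digraph X → Set
IsCopy H D = D ≅ H

-- SymClosure (A D) is the adjacency relation of the underlying undirected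
-- graph of D.
IsInduced : Graph X → Digraph X → Set
IsInduced G D = ∀ {u v} → V D u → V D v → Edge G u v Fun.⇔ SymClosure (A D) u v

IsInducedCopy : Graph X → Digraph Y → Digraph X → Set
IsInducedCopy G H D = (D ⊆ asDigraph G) × IsCopy H D × IsInduced G D

Extends : (G : Graph X) {D E : Digraph X} → asDigraph G ≅ asDigraph G → D ≅ E → Set
Extends G {D} σ φ =
  ∀ (u : ∃ (V D)) → proj₁ (_≅_.to σ (proj₁ u , tt)) ≡ proj₁ (_≅_.to φ u)

UH : Digraph Y → Graph X → Set₁
UH {X = X} H G =
  ∀ (D E : Digraph X) → IsInducedCopy G H D → IsInducedCopy G H E →
  (φ : D ≅ E) → ∃[ σ ] Extends G {D} {E} σ φ

-- f is what is done to A(H₁) before intersecting it with A(H₀).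
UniqueNeighbour : (Rel X 0ℓ → Rel X 0ℓ) → Digraph Y → Digraph Z → Graph X → Set₁
UniqueNeighbour {X = X} f H M G =
  ∀ (H₀ : Digraph X) → IsInducedCopy G H H₀ →
  ∀ (M₀ : Digraph X) → M₀ ⊆ H₀ → IsCopy M M₀ →
  ∃! _≈_ λ (H₁ : Digraph X) →
    IsInducedCopy G H H₁ ×
    ¬ (H₁ ≈ H₀) ×
    (V H₀ ∩ V H₁ ≐ V M₀) ×
    (A H₀ ∩ᵣ f (A H₁) ⇔ A M₀)

-- {H}_M
SubscriptUH : Digraph Y → Digraph Z → Graph X → Set₁
SubscriptUH H M G = UH M G × UH H G × UniqueNeighbour flip H M G

-- {H}^M
SuperscriptUH : Digraph Y → Digraph Z → Graph X → Set₁
SuperscriptUH H M G = UH M G × UH H G × UniqueNeighbour (λ R → R) H M G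

directedCycle : ∀ n → .{{NonZero n}} → Digraph (Fin n)
directedCycle n = record
  { V = U ; A = λ i j → j ≡ suc (toℕ i) mod n ; A⊆V×V = λ _ → tt , tt }

directedPath : ∀ n → Digraph (Fin n)
directedPath n = record
  { V = U ; A = λ i j → toℕ j ≡ suc (toℕ i) ; A⊆V×V = λ _ → tt , tt }

C⃗₆ : Digraph (Fin 6)
C⃗₆ = directedCycle 6

P⃗₃ : Digraph (Fin 3)
P⃗₃ = directedPath 3

symmetrise : (R : Rel X 0ℓ) → Irreflexive _≡_ R → Graph X
symmetrise R irr = record
  { Edge   = SymClosure R
  ; symm   = Sym.symmetric R
  ; irrefl = λ { eq (fwd r) → irr eq r ; eq (bwd r) → irr (sym eq) r }
  }

data PappusEdge : Rel (Fin 18) 0ℓ where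
  cycle  : (i : Fin 18) → PappusEdge i (suc (toℕ i) mod 18)
  chord₁ : (x : Fin 3) → PappusEdge ((1 + 6 * toℕ x) mod 18) ((6 + 6 * toℕ x) mod 18)
  chord₂ : (x : Fin 3) → PappusEdge ((2 + 6 * toℕ x) mod 18) ((9 + 6 * toℕ x) mod 18)
  chord₃ : (x : Fin 3) → PappusEdge ((4 + 6 * toℕ x) mod 18) ((11 + 6 * toℕ x) mod 18)

Pappus : Graph (Fin 18)
Pappus = symmetrise PappusEdge λ eq e → irr e eq
  where
  irr : ∀ {u v} → PappusEdge u v → ¬ (u ≡ v)
  irr (cycle i)  = from-yes (all? λ (i : Fin 18) → ¬? (i ≟ suc (toℕ i) mod 18)) i
  irr (chord₁ x) = from-yes (all? λ (x : Fin 3) → ¬? ((1 + 6 * toℕ x) mod 18 ≟ (6 + 6 * toℕ x) mod 18)) x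
  irr (chord₂ x) = from-yes (all? λ (x : Fin 3) → ¬? ((2 + 6 * toℕ x) mod 18 ≟ (9 + 6 * toℕ x) mod 18)) x
  irr (chord₃ x) = from-yes (all? λ (x : Fin 3) → ¬? ((4 + 6 * toℕ x) mod 18 ≟ (11 + 6 * toℕ x) mod 18)) x

-- x ⟨ j ⟩ is the vertex xⱼ = 4x + j of the 20-cycle.
_⟨_⟩ : Fin 5 → Fin 4 → Fin 20
x ⟨ j ⟩ = combine x j

_+2 : Fin 5 → Fin 5
x +2 = (toℕ x + 2) mod 5

data DesarguesEdge : Rel (Fin 20) 0ℓ where
  cycle  : (i : Fin 20) → DesarguesEdge i (suc (toℕ i) mod 20)
  chord₁ : (x : Fin 5) → DesarguesEdge (x ⟨ 3F ⟩) ((x +2) ⟨ 0F ⟩)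
  chord₂ : (x : Fin 5) → DesarguesEdge (x ⟨ 1F ⟩) ((x +2) ⟨ 2F ⟩)

Desargues : Graph (Fin 20)
Desargues = symmetrise DesarguesEdge λ eq e → irr e eq
  where
  irr : ∀ {u v} → DesarguesEdge u v → ¬ (u ≡ v)
  irr (cycle i)  = from-yes (all? λ (i : Fin 20) → ¬? (i ≟ suc (toℕ i) mod 20)) i
  irr (chord₁ x) = from-yes (all? λ (x : Fin 5) → ¬? (x ⟨ 3F ⟩ ≟ (x +2) ⟨ 0F ⟩)) x
  irr (chord₂ x) = from-yes (all? λ (x : Fin 5) → ¬? (x ⟨ 1F ⟩ ≟ (x +2) ⟨ 2F ⟩)) x

{-# OPTIONS --safe #-}
module Submission where

-- Both graphs have girth 6, and their automorphism groups (of orders 216 and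
-- 240) act simply transitively on parametrised hexagons, which gives the
-- C⃗₆-UH property; the P⃗₃-UH property follows because every 2-arc extends to a
-- hexagon.  Moreover every 2-arc lies on exactly two hexagons, and these meet
-- only in the 2-arc.  So the required neighbour of a hexagon along a 2-arc is
-- the other hexagon through it, traversed in the same direction for {C⃗₆}^P⃗₃
-- and backwards for {C⃗₆}_P⃗₃.

open import Defs
import Data.Fin as Fin
open import Data.Fin using (Fin; toℕ; #_; _↑ˡ_; opposite)
open import Data.Fin.Patterns using (0F; 1F; 2F; 3F; 4F; 5F)
open import Data.Fin.Properties using (all?; any?; _≟_; <⇒≢; pigeonhole; opposite-involutive)
import Data.Nat as ℕ
open import Data.Nat using (ℕ; zero; suc)
open import Data.Nat.DivMod using (_mod_)
open import Data.Nat.GeneralisedArithmetic using (fold)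
open import Data.List.Base as List
  using (List; []; _∷_; [_]; concatMap; filter; cartesianProductWith; iterate)
open import Data.List.Membership.Propositional using (_∈_)
open import Data.List.Membership.Propositional.Properties
  using (∈-map⁺; ∈-map⁻; ∈-filter⁺; ∈-filter⁻; ∈-concatMap⁺)
import Data.List.Membership.DecPropositional as DecMembership
import Data.List.Relation.Unary.All as All
open import Data.List.Relation.Unary.All using (All)
import Data.List.Relation.Unary.Any as Any
open import Data.List.Relation.Unary.Any using (here; there)
open import Data.Product using (_×_; _,_; ∃; ∃!; ∃₂; ∃-syntax; proj₁; proj₂; uncurry)
open import Data.Sum as Sum using (_⊎_; inj₁; inj₂)
open import Data.Unit using (tt)
open import Data.Empty using (⊥; ⊥-elim)
open import Data.Vec as Vec using (Vec; []; _∷_; lookup; tabulate)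
open import Data.Vec.Properties using (lookup∘tabulate; lookup-map)
import Data.Vec.Properties as Vecₚ
open import Function using (_∘_; flip)
import Function.Bundles as Fun
import Function.Construct.Composition as Composition
import Function.Construct.Identity as Identity
import Function.Construct.Symmetry as Symmetry
open import Level using (0ℓ)
open import Relation.Binary.Core using (Rel; _⇒_; _⇔_)
open import Relation.Binary.Construct.Intersection using () renaming (_∩_ to _∩ᵣ_)
import Relation.Binary.Construct.Closure.Symmetric as Sym
open Sym using (SymClosure; fwd; bwd)
open import Relation.Binary.Definitions using (Decidable)
open import Relation.Binary.PropositionalEquality
  using (_≡_; _≢_; _≗_; refl; sym; trans; cong; subst; subst₂)
import Relation.Nullary.Decidable as Dec
open import Relation.Nullary.Decidable
  using (Dec; True; toWitness; no; map′; from-yes; ¬?; _×-dec_; _⊎-dec_; _→-dec_)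
open import Relation.Nullary.Negation using (¬_; contradiction)
import Relation.Unary as Unary
open import Relation.Unary using (U; _∩_; _≐_) renaming (_⊆_ to _⊆ₚ_)

-- Decidability of arcs and the calculus of digraph isomorphisms.

C⃗₆-arc? : Decidable (A C⃗₆)
C⃗₆-arc? i j = j ≟ suc (toℕ i) mod 6

P⃗₃-arc? : Decidable (A P⃗₃)
P⃗₃-arc? i j = toℕ j ℕ.≟ suc (toℕ i)

private
  variable
    X Y Z : Set
    m n k : ℕ

to⇔ : {P Q : Set} → P Fun.⇔ Q → P → Q
to⇔ = Fun.Equivalence.to

from⇔ : {P Q : Set} → P Fun.⇔ Q → Q → P
from⇔ = Fun.Equivalence.from

_⇔-dec_ : {P Q : Set} → Dec P → Dec Q → Dec (P Fun.⇔ Q)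
p? ⇔-dec q? =
  map′ (uncurry Fun.mk⇔) (λ e → to⇔ e , from⇔ e) ((p? →-dec q?) ×-dec (q? →-dec p?))

symClosure? : {R : Rel X 0ℓ} → Decidable R → Decidable (SymClosure R)
symClosure? R? x y =
  map′ (λ { (inj₁ r) → fwd r ; (inj₂ r) → bwd r })
       (λ { (fwd r) → inj₁ r ; (bwd r) → inj₂ r })
       (R? x y ⊎-dec R? y x)

≅-refl : {D : Digraph X} → D ≅ D
≅-refl {D = D} = record
  { bijection = Identity.inverse (vertices D)
  ; arcs      = λ _ _ → Identity.equivalence _
  }

≅-sym : {D : Digraph X} {E : Digraph Y} → D ≅ E → E ≅ D
≅-sym {D = D} {E = E} φ = record
  { bijection = Symmetry.inverse bijection
  ; arcs      = λ u v → Symmetry.equivalence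
      (subst₂ (λ x y → _ Fun.⇔ A E x y)
        (strictlyInverseˡ u) (strictlyInverseˡ v) (arcs (from u) (from v)))
  }
  where
  open _≅_ φ
  open Fun.Inverse bijection using (strictlyInverseˡ)

≅-trans : {D : Digraph X} {E : Digraph Y} {F : Digraph Z} → D ≅ E → E ≅ F → D ≅ F
≅-trans φ ψ = record
  { bijection = Composition.inverse (_≅_.bijection φ) (_≅_.bijection ψ)
  ; arcs      = λ u v → Composition.equivalence
                  (_≅_.arcs φ u v) (_≅_.arcs ψ (_≅_.to φ u) (_≅_.to φ v))
  }

-- Induced copies and parametrised embeddings.

Aut : Graph X → Set
Aut G = asDigraph G ≅ asDigraph G

act : {G : Graph X} → Aut G → X → X
act σ u = proj₁ (_≅_.to σ (u , tt))

-- Parametrised form of an induced copy: a bare map of vertices replaces a vertex predicate and an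
-- arc relation, so between finite vertex types the condition can be decided and its solutions
-- enumerated. Containment in `G` is part of `induced`, as `edge` shows.
record IsEmbedding (H : Digraph Y) (G : Graph X) (f : Y → X) : Set where
  constructor embedding
  field
    injective : ∀ i j → f i ≡ f j → i ≡ j
    induced   : ∀ i j → Edge G (f i) (f j) Fun.⇔ SymClosure (A H) i j

  edge : ∀ {i j} → A H i j → Edge G (f i) (f j)
  edge a = from⇔ (induced _ _) (fwd a)

open IsEmbedding

embedding-resp-≗ : {H : Digraph Y} {G : Graph X} {f g : Y → X} →
                   f ≗ g → IsEmbedding H G f → IsEmbedding H G g
embedding-resp-≗ {G = G} f≗g e .injective i j eq =
  injective e i j (trans (f≗g i) (trans eq (sym (f≗g j))))
embedding-resp-≗ {G = G} f≗g e .induced i j =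
  subst₂ (λ x y → Edge G x y Fun.⇔ _) (f≗g i) (f≗g j) (induced e i j)

embedding? : {H : Digraph (Fin m)} {G : Graph (Fin n)} →
             Decidable (A H) → Decidable (Edge G) → Unary.Decidable (IsEmbedding H G)
embedding? A? Edge? f = map′ (uncurry embedding) (λ e → injective e , induced e)
  ((all? λ i → all? λ j → (f i ≟ f j) →-dec (i ≟ j)) ×-dec
   (all? λ i → all? λ j → Edge? (f i) (f j) ⇔-dec symClosure? A? i j))

image : Digraph Y → (Y → X) → Digraph X
image H f = record
  { V      = λ x → ∃[ i ] V H i × f i ≡ x
  ; A      = λ x y → ∃₂ λ i j → A H i j × f i ≡ x × f j ≡ y
  ; A⊆V×V = λ (i , j , a , p , q) →
      (i , proj₁ (A⊆V×V H a) , p) , (j , proj₂ (A⊆V×V H a) , q)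
  }

module _ {H : Digraph Y} (full : ∀ i → V H i) where

  module Parametrisation {D : Digraph X} (δ : D ≅ H) where
    open _≅_ δ
    open Fun.Inverse bijection using (from-cong; strictlyInverseˡ; strictlyInverseʳ)

    param : Y → X
    param i = proj₁ (from (i , full i))

    param∈V : ∀ i → V D (param i)
    param∈V i = proj₂ (from (i , full i))

    V⇒param : ∀ {u} → V D u → ∃[ i ] param i ≡ u
    V⇒param {u} p = proj₁ (to (u , p)) ,
      -- The membership proof returned by `to` and the one supplied by `full` may differ; the vertex
      -- setoids ignore such proofs, so `from-cong refl` bridges the two.
      trans (from-cong refl) (strictlyInverseʳ (u , p))

    param-injective : ∀ i j → param i ≡ param j → i ≡ j
    param-injective i j eq = trans (sym (strictlyInverseˡ (i , full i)))
      (trans (Fun.Inverse.to-cong bijection eq) (strictlyInverseˡ (j , full j)))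

    arc : ∀ i j → A D (param i) (param j) Fun.⇔ A H i j
    arc i j = subst₂ (λ x y → _ Fun.⇔ A H x y)
      (strictlyInverseˡ (i , full i)) (strictlyInverseˡ (j , full j))
      (arcs (from (i , full i)) (from (j , full j)))

    A⇒param : ∀ {u v} → A D u v → ∃₂ λ i j → A H i j × param i ≡ u × param j ≡ v
    A⇒param a with V⇒param (proj₁ (A⊆V×V D a)) | V⇒param (proj₂ (A⊆V×V D a))
    ... | i , refl | j , refl = i , j , to⇔ (arc i j) a , refl , refl

  open Parametrisation using (param) public

  module _ {D E : Digraph X} (δ : D ≅ H) (ε : E ≅ H) (eq : param δ ≗ param ε) where
    private
      module D = Parametrisation δ
      module E = Parametrisation ε

    param≗⇒⊆ : D ⊆ E
    param≗⇒⊆ .proj₁ p with D.V⇒param p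
    ... | i , refl = subst (V E) (sym (eq i)) (E.param∈V i)
    param≗⇒⊆ .proj₂ a with D.A⇒param a
    ... | i , j , b , refl , refl =
      subst₂ (A E) (sym (eq i)) (sym (eq j)) (from⇔ (E.arc i j) b)

  param≗⇒≈ : {D E : Digraph X} (δ : D ≅ H) (ε : E ≅ H) → param δ ≗ param ε → D ≈ E
  param≗⇒≈ {D = D} {E} δ ε eq = (proj₁ D⊆E , proj₁ E⊆D) , (proj₂ D⊆E , proj₂ E⊆D)
    where
    D⊆E : D ⊆ E
    D⊆E = param≗⇒⊆ δ ε eq
    E⊆D : E ⊆ D
    E⊆D = param≗⇒⊆ ε δ (sym ∘ eq)

  module _ {G : Graph X} where

    induced⇒embedding : {D : Digraph X} (δ : D ≅ H) → IsInduced G D → IsEmbedding H G (param δ)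
    induced⇒embedding {D} δ ind .injective = Parametrisation.param-injective δ
    induced⇒embedding {D} δ ind .induced i j =
      Composition.equivalence (ind (param∈V i) (param∈V j)) (Fun.mk⇔
        (λ { (fwd a) → fwd (to⇔ (arc i j) a) ; (bwd a) → bwd (to⇔ (arc j i) a) })
        (λ { (fwd a) → fwd (from⇔ (arc i j) a) ; (bwd a) → bwd (from⇔ (arc j i) a) }))
      where open Parametrisation δ

    module _ {f : Y → X} (e : IsEmbedding H G f) where

      image-≅ : image H f ≅ H
      image-≅ = record
        { bijection = record
          { to        = λ (_ , i , _) → i , full i
          ; from      = λ (i , _) → f i , i , full i , refl
          ; to-cong   = λ { {_ , i , _ , p} {_ , j , _ , q} eq →
                            injective e i j (trans p (trans eq (sym q))) }
          ; from-cong = cong f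
          ; inverse   = (λ { {i , _} {_ , j , _ , p} eq → injective e j i (trans p eq) })
                      , (λ { {_ , i , _ , p} eq → trans (cong f eq) p })
          }
        ; arcs = λ { (_ , i , _ , refl) (_ , j , _ , refl) → Fun.mk⇔
            (λ (i′ , j′ , a , p , q) →
               subst₂ (A H) (injective e i′ i p) (injective e j′ j q) a)
            (λ a → i , j , a , refl , refl) }
        }

      image-induced : IsInduced G (image H f)
      image-induced (i , _ , refl) (j , _ , refl) =
        Composition.equivalence (induced e i j) (Fun.mk⇔
          (λ { (fwd a) → fwd (i , j , a , refl , refl)
             ; (bwd a) → bwd (j , i , a , refl , refl) })
          (λ { (fwd (i′ , j′ , a , p , q)) →
                 fwd (subst₂ (A H) (injective e i′ i p) (injective e j′ j q) a)
             ; (bwd (j′ , i′ , a , q , p)) →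
                 bwd (subst₂ (A H) (injective e j′ j q) (injective e i′ i p) a) }))

      image-isInducedCopy : IsInducedCopy G H (image H f)
      image-isInducedCopy =
        ((λ _ → tt) , λ { (i , j , a , refl , refl) → edge e a }) ,
        image-≅ , (λ {u} {v} → image-induced {u} {v})

    -- Parametrise `D` by `δ` and transport this parametrisation along `φ` to `E`. If `σ` and `τ`
    -- carry the base embedding `b` to these two parametrisations, then `τ` after the inverse of `σ`
    -- agrees with `φ` on every vertex of `D`.
    UH-fromOrbit : (b : Y → X) →
      (∀ f → IsEmbedding H G f → ∃[ σ ] act {G = G} σ ∘ b ≗ f) → UH H G
    UH-fromOrbit b reach D E (D⊆G , δ , D-ind) (E⊆G , ε , E-ind) φ =
      ≅-trans (≅-sym σ) τ , λ (u , p) → extends u p (V⇒param p)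
      where
      open Parametrisation δ using (V⇒param; param∈V)
      δ′ : E ≅ H
      δ′ = ≅-trans (≅-sym φ) δ
      σ,σb≗ = reach (param δ) (induced⇒embedding δ D-ind)
      τ,τb≗ = reach (param δ′) (induced⇒embedding δ′ E-ind)
      σ = proj₁ σ,σb≗
      τ = proj₁ τ,τb≗
      extends : ∀ u (p : V D u) → ∃[ i ] param δ i ≡ u →
                proj₁ (_≅_.to (≅-trans (≅-sym σ) τ) (u , tt)) ≡ proj₁ (_≅_.to φ (u , p))
      extends u p (i , refl) = trans
        (cong (act {G = G} τ) (Fun.Inverse.inverseʳ (_≅_.bijection σ) (sym (proj₂ σ,σb≗ i))))
        (trans (proj₂ τ,τb≗ i) (Fun.Inverse.to-cong (_≅_.bijection φ) refl))

-- Rotation and reversal of the directed hexagon.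

rotate : Fin 6 → Fin 6 → Fin 6
rotate k i = (toℕ k ℕ.+ toℕ i) mod 6

rotation : Fin 6 → C⃗₆ ≅ C⃗₆
rotation k = record
  { bijection = record
    -- `param` reads the inverse map, so `rotate k` is placed in `from`: after composing with this
    -- isomorphism, index `i` names the vertex formerly at `k + i`.
    { to        = λ (i , _) → rotate k⁻¹ i , tt
    ; from      = λ (i , _) → rotate k i , tt
    ; to-cong   = cong (rotate k⁻¹)
    ; from-cong = cong (rotate k)
    ; inverse   = (λ { {i , _} refl → proj₁ (rotates k) i })
                , (λ { {i , _} refl → proj₁ (proj₂ (rotates k)) i })
    }
  ; arcs = λ (i , _) (j , _) → proj₂ (proj₂ (rotates k)) i j
  }
  where
  inverse : Fin 6 → Fin 6
  -- For `k = 0` the difference is 6, which the reduction turns into 0.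
  inverse k = (6 ℕ.∸ toℕ k) mod 6
  k⁻¹ : Fin 6
  k⁻¹ = inverse k
  rotates : ∀ k → (∀ i → rotate (inverse k) (rotate k i) ≡ i) ×
                  (∀ i → rotate k (rotate (inverse k) i) ≡ i) ×
                  (∀ i j → A C⃗₆ i j Fun.⇔ A C⃗₆ (rotate (inverse k) i) (rotate (inverse k) j))
  rotates = from-yes (all? λ k →
    (all? λ i → rotate (inverse k) (rotate k i) ≟ i) ×-dec
    (all? λ i → rotate k (rotate (inverse k) i) ≟ i) ×-dec
    (all? λ i → all? λ j → C⃗₆-arc? i j ⇔-dec C⃗₆-arc? (rotate (inverse k) i) (rotate (inverse k) j)))

full : {n : ℕ} (i : Fin n) → U i
full _ = tt

start : Fin 3 → Fin 6
start = _↑ˡ 3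

-- The arc of the cycle that wraps around starts at 5, outside the first three vertices. The
-- converse direction is what turns arcs shared by two hexagons back into arcs of the path.
start-arc : ∀ k l → A P⃗₃ k l Fun.⇔ A C⃗₆ (start k) (start l)
start-arc = from-yes (all? λ k → all? λ l → P⃗₃-arc? k l ⇔-dec C⃗₆-arc? (start k) (start l))

module _ {D : Digraph X} (δ : D ≅ C⃗₆) where
  open Parametrisation {H = C⃗₆} full δ using (A⇒param; param-injective)

  -- The two arcs of the path have indices `i → j` and `i′ → j′`; injectivity at the middle vertex
  -- gives `i′ = j`, so the path occupies `i`, `i + 1`, `i + 2` and rotation by `i` moves it to the
  -- front. Hence only paths of the form `start` need to be treated later.
  rotateTo : (p : Fin 3 → X) → (∀ k l → A P⃗₃ k l → A D (p k) (p l)) →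
             ∃[ ε ] param {H = C⃗₆} full {D = D} ε ∘ start ≗ p
  rotateTo p arcs with A⇒param (arcs 0F 1F refl) | A⇒param (arcs 1F 2F refl)
  ... | i , j , i→j , pi , pj | i′ , j′ , i′→j′ , pi′ , pj′ = ≅-trans δ (rotation i) , λ
    { 0F → trans (at (proj₁ (rotates i))) pi
    ; 1F → trans (at (trans (proj₁ (proj₂ (rotates i))) (sym i→j))) pj
    ; 2F → trans (at (trans (proj₂ (proj₂ (rotates i))) (sym two))) pj′
    }
    where
    at : ∀ {a b} → a ≡ b → param {H = C⃗₆} full δ a ≡ param {H = C⃗₆} full δ b
    at = cong (param {H = C⃗₆} full δ)
    two : j′ ≡ suc (toℕ (suc (toℕ i) mod 6)) mod 6
    two = trans i′→j′ (cong (λ a → suc (toℕ a) mod 6)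
            (trans (param-injective i′ j (trans pi′ (sym pj))) i→j))
    rotates : ∀ i → rotate i 0F ≡ i × rotate i 1F ≡ suc (toℕ i) mod 6 ×
                    rotate i 2F ≡ suc (toℕ (suc (toℕ i) mod 6)) mod 6
    rotates = from-yes (all? λ i → (rotate i 0F ≟ i) ×-dec
      (rotate i 1F ≟ suc (toℕ i) mod 6) ×-dec
      (rotate i 2F ≟ suc (toℕ (suc (toℕ i) mod 6)) mod 6))

reverse : Digraph X → Digraph X
reverse D = record
  { V = V D ; A = flip (A D) ; A⊆V×V = λ a → proj₂ (A⊆V×V D a) , proj₁ (A⊆V×V D a) }

reverse-≅ : {D : Digraph X} {E : Digraph Y} → D ≅ E → reverse D ≅ reverse E
reverse-≅ φ = record { bijection = _≅_.bijection φ ; arcs = flip (_≅_.arcs φ) }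

C⃗₆-reversible : reverse C⃗₆ ≅ C⃗₆
C⃗₆-reversible = record
  { bijection = record
    { to        = λ (i , _) → opposite i , tt
    ; from      = λ (i , _) → opposite i , tt
    ; to-cong   = cong opposite
    ; from-cong = cong opposite
    ; inverse   = (λ { {i , _} refl → opposite-involutive i })
                , (λ { {i , _} refl → opposite-involutive i })
    }
  ; arcs = λ (i , _) (j , _) → reverses i j
  }
  where
  reverses : ∀ i j → A C⃗₆ j i Fun.⇔ A C⃗₆ (opposite i) (opposite j)
  reverses = from-yes (all? λ i → all? λ j → C⃗₆-arc? j i ⇔-dec C⃗₆-arc? (opposite i) (opposite j))

reverse-isInducedCopy : {G : Graph X} {D : Digraph X} →
                        IsInducedCopy G C⃗₆ D → IsInducedCopy G C⃗₆ (reverse D)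
reverse-isInducedCopy {G = G} ((_ , A⊆) , δ , ind) =
  ((λ _ → tt) , λ a → Graph.symm G (A⊆ a)) ,
  ≅-trans (reverse-≅ δ) C⃗₆-reversible ,
  λ p q → Composition.equivalence (ind p q) (Fun.mk⇔ swap swap)
  where
  swap : {R : Rel X 0ℓ} {x y : X} → SymClosure R x y → SymClosure (flip R) x y
  swap (fwd r) = bwd r
  swap (bwd r) = fwd r

-- H₀ has six vertices and M₀ only three.
V-⊈ : {H₀ H₁ M₀ : Digraph X} → H₀ ≅ C⃗₆ → M₀ ≅ P⃗₃ →
      V H₀ ∩ V H₁ ⊆ₚ V M₀ → ¬ V H₀ ⊆ₚ V H₁
V-⊈ {H₀ = H₀} {M₀ = M₀} δ μ ∩⊆ ⊆H₁ = collide (pigeonhole (from-yes (3 ℕ.<? 6)) index)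
  where
  module H₀ = Parametrisation {H = C⃗₆} full δ
  module M₀ = Parametrisation {H = P⃗₃} full μ
  inM₀ : ∀ i → ∃[ k ] M₀.param k ≡ H₀.param i
  inM₀ i = M₀.V⇒param (∩⊆ (H₀.param∈V i , ⊆H₁ (H₀.param∈V i)))
  index : Fin 6 → Fin 3
  index i = proj₁ (inM₀ i)
  collide : ¬ (∃₂ λ i j → i Fin.< j × index i ≡ index j)
  collide (i , j , i<j , eq) = <⇒≢ i<j (H₀.param-injective i j
    (trans (sym (proj₂ (inM₀ i))) (trans (cong M₀.param eq) (proj₂ (inM₀ j)))))

-- Traversing H₁ backwards exchanges the two kinds of neighbours.
reverse-uniqueNeighbour : {G : Graph X} →
  UniqueNeighbour (λ R → R) C⃗₆ P⃗₃ G → UniqueNeighbour flip C⃗₆ P⃗₃ G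
reverse-uniqueNeighbour {G = G} neighbour H₀ c₀@(_ , δ , _) M₀ M₀⊆H₀ μ
  with neighbour H₀ c₀ M₀ M₀⊆H₀ μ
... | H₁ , (c₁ , H₁≉H₀ , V∩ , A∩) , unique =
  reverse H₁ ,
  -- Flipping the reversed arcs gives back the original ones by computation, so `V∩` and `A∩` carry
  -- over unchanged. Being different from `H₀` does not transfer along reversal and is derived
  -- afresh from the vertex count.
  (reverse-isInducedCopy {G = G} {D = H₁} c₁ , distinct {reverse H₁} V∩ , V∩ , A∩) ,
  λ {H₁′} (c₁′ , _ , V∩′ , A∩′) →
    let V≐ , A⇒ , A⇐ = unique {reverse H₁′}
          (reverse-isInducedCopy {G = G} {D = H₁′} c₁′ , distinct {reverse H₁′} V∩′ , V∩′ , A∩′)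
    in V≐ , (λ a → A⇒ a) , (λ a → A⇐ a)
  where
  distinct : ∀ {H} → V H₀ ∩ V H ≐ V M₀ → ¬ (H ≈ H₀)
  distinct {H} (∩⊆ , _) ((_ , H₀⊆H) , _) = V-⊈ {H₀ = H₀} {H₁ = H} δ μ ∩⊆ H₀⊆H

-- Companion hexagons and the unique-neighbour property.

MeetInPath : (f g : Fin 6 → X) → Set
MeetInPath f g = ∀ i j → f i ≡ g j → i ≡ j × ∃[ k ] start k ≡ i

-- Fixing the first three vertices fixes both the starting point and the sense of traversal, so
-- `only` can compare maps pointwise. Because `meet` also equates the indices of a common vertex, a
-- shared arc has the same indices on both sides and these lie in `start`; the arc intersection is
-- thus controlled along with the vertex intersection.
record Companion (G : Graph X) (h y : Fin 6 → X) : Set where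
  field
    isEmbedding : IsEmbedding C⃗₆ G y
    start≗      : y ∘ start ≗ h ∘ start
    meet        : MeetInPath h y
    only        : ∀ g → IsEmbedding C⃗₆ G g → g ∘ start ≗ h ∘ start → g ≗ h ⊎ g ≗ y

module _ {G : Graph X} where

  module _ {H₀ M₀ : Digraph X} (M₀⊆H₀ : M₀ ⊆ H₀) (δ : H₀ ≅ C⃗₆) (μ : M₀ ≅ P⃗₃)
           (h≗M : param {H = C⃗₆} full δ ∘ start ≗ param {H = P⃗₃} full μ)
           {y : Fin 6 → X} (companion : Companion G (param {H = C⃗₆} full δ) y) where
    private
      open Companion companion
      module H = Parametrisation {H = C⃗₆} full δ
      module M = Parametrisation {H = P⃗₃} full μ

      h : Fin 6 → X
      h = H.param

      y≗M : y ∘ start ≗ M.param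
      y≗M k = trans (start≗ k) (h≗M k)

      H₁ : Digraph X
      H₁ = image C⃗₆ y

      V∩ : V H₀ ∩ V H₁ ≐ V M₀
      V∩ = common , λ v∈ → proj₁ M₀⊆H₀ v∈ , shared (M.V⇒param v∈)
        where
        common : V H₀ ∩ V H₁ ⊆ₚ V M₀
        common (v∈ , j , _ , refl) with H.V⇒param v∈
        ... | i , hi≡yj with meet i j hi≡yj
        ... | refl , k , refl = subst (V M₀) (sym (y≗M k)) (M.param∈V k)
        shared : ∀ {v} → ∃[ k ] M.param k ≡ v → V H₁ v
        shared (k , refl) = start k , tt , y≗M k

      A∩ : A H₀ ∩ᵣ A H₁ ⇔ A M₀
      A∩ = common , λ a → proj₂ M₀⊆H₀ a , shared (M.A⇒param a)
        where
        common : A H₀ ∩ᵣ A H₁ ⇒ A M₀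
        common (a , i′ , j′ , i′→j′ , refl , refl)
          with H.V⇒param (proj₁ (A⊆V×V H₀ a)) | H.V⇒param (proj₂ (A⊆V×V H₀ a))
        ... | i , hi≡ | j , hj≡ with meet i i′ hi≡ | meet j j′ hj≡
        ... | refl , k , refl | refl , l , refl =
          subst₂ (A M₀) (sym (y≗M k)) (sym (y≗M l))
            (from⇔ (M.arc k l) (from⇔ (start-arc k l) i′→j′))
        shared : ∀ {u v} → ∃₂ (λ k l → A P⃗₃ k l × M.param k ≡ u × M.param l ≡ v) → A H₁ u v
        shared (k , l , k→l , refl , refl) =
          start k , start l , to⇔ (start-arc k l) k→l , y≗M k , y≗M l

      -- The arcs of `M₀` lie in `E`, so `E` can be reparametrised to begin along `M₀`, and `only`
      -- leaves `h` or `y`. The case `h` would put all six vertices of `H₀` into `E`, against the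
      -- intersection being `V M₀`.
      unique : ∀ {E} → IsInducedCopy G C⃗₆ E × ¬ (E ≈ H₀) ×
               (V H₀ ∩ V E ≐ V M₀) × (A H₀ ∩ᵣ A E ⇔ A M₀) → H₁ ≈ E
      unique {E} ((_ , ε₀ , ind) , _ , (V∩⊆ , _) , _ , A⊆∩) = conclude (only g
        (induced⇒embedding {H = C⃗₆} full {G = G} ε ind)
        (λ k → trans (proj₂ aligned k) (sym (h≗M k))))
        where
        aligned : ∃[ ε ] param {H = C⃗₆} full {D = E} ε ∘ start ≗ M.param
        aligned = rotateTo ε₀ M.param (λ k l a → proj₂ (A⊆∩ (from⇔ (M.arc k l) a)))
        ε : E ≅ C⃗₆
        ε = proj₁ aligned
        g : Fin 6 → X
        g = param {H = C⃗₆} full ε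
        conclude : g ≗ h ⊎ g ≗ y → H₁ ≈ E
        conclude (inj₁ g≗h) = ⊥-elim (V-⊈ {H₀ = H₀} {H₁ = E} δ μ V∩⊆
          (proj₁ (param≗⇒⊆ {H = C⃗₆} full δ ε (sym ∘ g≗h))))
        conclude (inj₂ g≗y) = param≗⇒≈ {H = C⃗₆} full
          (image-≅ {H = C⃗₆} full {G = G} isEmbedding) ε (sym ∘ g≗y)

    neighbour : ∃! _≈_ λ E → IsInducedCopy G C⃗₆ E × ¬ (E ≈ H₀) ×
                (V H₀ ∩ V E ≐ V M₀) × (A H₀ ∩ᵣ A E ⇔ A M₀)
    neighbour = H₁ ,
      (image-isInducedCopy {H = C⃗₆} full {G = G} isEmbedding ,
       (λ ((_ , H₀⊆H₁) , _) → V-⊈ {H₀ = H₀} {H₁ = H₁} δ μ (proj₁ V∩) H₀⊆H₁) ,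
       V∩ , A∩) ,
      unique

  -- Rotating the parametrisation of `H₀` makes `M₀` its first three vertices, and the companion of
  -- this rotated hexagon is the neighbour sought.
  companions⇒uniqueNeighbour : (∀ h → IsEmbedding C⃗₆ G h → ∃ (Companion G h)) →
                               UniqueNeighbour (λ R → R) C⃗₆ P⃗₃ G
  companions⇒uniqueNeighbour companions H₀ (_ , δ₀ , ind₀) M₀ M₀⊆H₀ μ =
    neighbour M₀⊆H₀ δ μ (proj₂ aligned)
      (proj₂ (companions (param {H = C⃗₆} full δ)
        (induced⇒embedding {H = C⃗₆} full {G = G} δ ind₀)))
    where
    module M = Parametrisation {H = P⃗₃} full μ
    aligned : ∃[ δ ] param {H = C⃗₆} full {D = H₀} δ ∘ start ≗ M.param
    aligned = rotateTo δ₀ M.param (λ k l a → proj₂ M₀⊆H₀ (from⇔ (M.arc k l) a))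
    δ : H₀ ≅ C⃗₆
    δ = proj₁ aligned

-- Exhaustive enumeration of hexagons.

_∈?_ : (u : Fin n) (us : List (Fin n)) → Dec (u ∈ us)
_∈?_ = DecMembership._∈?_ _≟_

-- Explicit neighbour lists let the searches follow walks in the graph instead of running through
-- all 6-tuples of vertices.
module Hexagons
  (G : Graph (Fin n))
  (neighbours : Fin n → List (Fin n))
  (∈-neighbours : ∀ u v → v ∈ neighbours u Fun.⇔ Edge G u v)
  where

  open DecMembership (Vecₚ.≡-dec {n = 6} (_≟_ {n})) using () renaming (_∈?_ to _∈ᵛ?_)

  edge? : Decidable (Edge G)
  edge? u v = Dec.map (∈-neighbours u v) (v ∈? neighbours u)

  Hexagon : Vec (Fin n) 6 → Set
  Hexagon x = IsEmbedding C⃗₆ G (lookup x)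

  hexagon? : Unary.Decidable Hexagon
  hexagon? x = embedding? C⃗₆-arc? edge? (lookup x)

  -- The starting vertex is left out: the vector holds the `k` vertices visited after it, and the
  -- callers prepend it.
  walks : Fin n → ∀ k → List (Vec (Fin n) k)
  walks u zero    = [ [] ]
  walks u (suc k) = concatMap (λ v → List.map (v ∷_) (walks v k)) (neighbours u)

  ∈-walks : ∀ {u v} {x : Vec (Fin n) k} → Edge G u v → x ∈ walks v k → v ∷ x ∈ walks u (suc k)
  ∈-walks {u = u} {v} uv x∈ =
    ∈-concatMap⁺ _ (Any.map (λ { refl → ∈-map⁺ (v ∷_) x∈ }) (from⇔ (∈-neighbours u v) uv))

  hexagonsFrom : Fin n → List (Vec (Fin n) 6)
  -- A walk of five steps need not be injective, close up or be induced; the filter tests all three.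
  hexagonsFrom u = filter hexagon? (List.map (u ∷_) (walks u 5))

  hexagonsThrough : Fin n → Fin n → Fin n → List (Vec (Fin n) 6)
  hexagonsThrough u v w = filter hexagon? (List.map (λ x → u ∷ v ∷ w ∷ x) (walks w 3))

  module _ {f : Fin 6 → Fin n} (e : IsEmbedding C⃗₆ G f) where

    tabulate-hexagon : Hexagon (tabulate f)
    tabulate-hexagon = embedding-resp-≗ {H = C⃗₆} {G = G} (sym ∘ lookup∘tabulate f) e

    private
      last : f 3F ∷ f 4F ∷ f 5F ∷ [] ∈ walks (f 2F) 3
      last = ∈-walks (edge e refl) (∈-walks (edge e refl) (∈-walks (edge e refl) (here refl)))

    ∈-hexagonsFrom : tabulate f ∈ hexagonsFrom (f 0F)
    ∈-hexagonsFrom = ∈-filter⁺ hexagon?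
      (∈-map⁺ (f 0F ∷_) (∈-walks (edge e refl) (∈-walks (edge e refl) last)))
      tabulate-hexagon

    ∈-hexagonsThrough : ∀ {u v w} → f 0F ≡ u → f 1F ≡ v → f 2F ≡ w →
                        tabulate f ∈ hexagonsThrough u v w
    ∈-hexagonsThrough refl refl refl = ∈-filter⁺ hexagon?
      (∈-map⁺ (λ x → f 0F ∷ f 1F ∷ f 2F ∷ x) last) tabulate-hexagon

  ∈-hexagonsThrough⁻ : ∀ (p : Fin 3 → Fin n) {x} → x ∈ hexagonsThrough (p 0F) (p 1F) (p 2F) →
                       Hexagon x × lookup x ∘ start ≗ p
  ∈-hexagonsThrough⁻ p {x} x∈ = proj₂ filtered , begins (proj₂ (proj₂ mapped))
    where
    extend : Vec (Fin n) 3 → Vec (Fin n) 6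
    extend z = p 0F ∷ p 1F ∷ p 2F ∷ z
    filtered = ∈-filter⁻ hexagon? {xs = List.map extend (walks (p 2F) 3)} x∈
    mapped = ∈-map⁻ extend (proj₁ filtered)
    begins : ∀ {z} → x ≡ extend z → lookup x ∘ start ≗ p
    begins refl = λ { 0F → refl ; 1F → refl ; 2F → refl }

  -- Meant for the list of hexagons through a 2-arc: length two expresses that a hexagon has exactly
  -- one other beside it. The meeting condition also forces the two entries to differ, since equal
  -- ones would meet outside the path.
  Pencil : List (Vec (Fin n) 6) → Set
  Pencil (x ∷ y ∷ []) = MeetInPath (lookup x) (lookup y)
  Pencil _            = ⊥

  pencil? : Unary.Decidable Pencil
  pencil? []                = no λ ()
  pencil? (_ ∷ [])          = no λ ()
  pencil? (x ∷ y ∷ [])      = all? λ i → all? λ j →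
    (lookup x i ≟ lookup y j) →-dec ((i ≟ j) ×-dec any? λ k → start k ≟ i)
  pencil? (_ ∷ _ ∷ _ ∷ _)   = no λ ()

  pencil-nonempty : ∀ {xs} → Pencil xs → ∃ (_∈ xs)
  pencil-nonempty {x ∷ _ ∷ []} _ = x , here refl

  pencil-other : ∀ {xs x} → Pencil xs → x ∈ xs →
                 ∃[ y ] y ∈ xs × MeetInPath (lookup x) (lookup y) × (∀ {z} → z ∈ xs → z ≡ x ⊎ z ≡ y)
  pencil-other {x ∷ y ∷ []} meet (here refl) = y , there (here refl) , meet ,
    λ { (here eq) → inj₁ eq ; (there (here eq)) → inj₂ eq }
  pencil-other {x ∷ y ∷ []} meet (there (here refl)) = x , here refl ,
    (λ i j eq → meetᵒ i j (meet j i (sym eq))) ,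
    λ { (here eq) → inj₂ eq ; (there (here eq)) → inj₁ eq }
    where
    meetᵒ : ∀ i j → j ≡ i × ∃[ k ] start k ≡ j → i ≡ j × ∃[ k ] start k ≡ i
    meetᵒ _ _ (refl , k) = refl , k

  Pencils : Set
  Pencils = ∀ u → All (λ v → All (λ w → u ≢ w → Pencil (hexagonsThrough u v w))
                        (neighbours v)) (neighbours u)

  pencils? : Dec Pencils
  pencils? = all? λ u → All.all? (λ v → All.all? (λ w →
    ¬? (u ≟ w) →-dec pencil? (hexagonsThrough u v w)) (neighbours v)) (neighbours u)

  -- Orbits of hexagons and certified automorphisms.

  orbit : List (Aut G) → Vec (Fin n) 6 → List (Vec (Fin n) 6)
  orbit Γ b = List.map (λ σ → Vec.map (act {G = G} σ) b) Γ

  Transitive : List (Aut G) → Vec (Fin n) 6 → Set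
  Transitive Γ b = ∀ u → All (_∈ orbit Γ b) (hexagonsFrom u)

  transitive? : ∀ Γ b → Dec (Transitive Γ b)
  transitive? Γ b = all? λ u → All.all? (_∈ᵛ? orbit Γ b) (hexagonsFrom u)

  -- A period makes a single table of images sufficient: when the period is `k + 1`, the inverse is
  -- the `k`-th power, and edges are reflected because applying the permutation `k` more times
  -- returns them to where they came from.
  PeriodicAutomorphism : Vec (Fin n) n → ℕ → Set
  PeriodicAutomorphism p k = (∀ u → fold u (lookup p) k ≡ u) ×
    (∀ u → All (λ v → lookup p v ∈ neighbours (lookup p u)) (neighbours u))

  periodicAutomorphism? : ∀ p k → Dec (PeriodicAutomorphism p k)
  periodicAutomorphism? p k = (all? λ u → fold u (lookup p) k ≟ u) ×-dec
    (all? λ u → All.all? (λ v → lookup p v ∈? neighbours (lookup p u)) (neighbours u))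

  automorphism : ∀ p k → PeriodicAutomorphism p (suc k) → Aut G
  automorphism p k (order , preserves) = record
    { bijection = record
      { to        = λ (u , _) → π u , tt
      ; from      = λ (u , _) → fold u π k , tt
      ; to-cong   = cong π
      ; from-cong = cong (λ u → fold u π k)
      ; inverse   = (λ { {u , _} refl → order u })
                  , (λ { {u , _} refl → returns u })
      }
    ; arcs = λ (u , _) (v , _) → Fun.mk⇔ (edge⁺ u v) (λ e →
        subst₂ (Edge G) (returns u) (returns v) (edge⁺ᵏ k e))
    }
    where
    π : Fin n → Fin n
    π = lookup p
    returns : ∀ u → fold (π u) π k ≡ u
    returns u = trans (shift k) (order u)
      where
      shift : ∀ j → fold (π u) π j ≡ fold u π (suc j)
      shift zero    = refl
      shift (suc j) = cong π (shift j)
    edge⁺ : ∀ u v → Edge G u v → Edge G (π u) (π v)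
    edge⁺ u v e = to⇔ (∈-neighbours (π u) (π v))
      (All.lookup (preserves u) (from⇔ (∈-neighbours u v) e))
    edge⁺ᵏ : ∀ j {u v} → Edge G u v → Edge G (fold u π j) (fold v π j)
    edge⁺ᵏ zero    e = e
    edge⁺ᵏ (suc j) e = edge⁺ _ _ (edge⁺ᵏ j e)

  -- The powers p⁰, …, pᵏ of a permutation of period k + 1.
  powers : ∀ p k {_ : True (periodicAutomorphism? p (suc k))} → List (Aut G)
  powers p k {t} = iterate (λ τ → ≅-trans τ (automorphism p k (toWitness t))) ≅-refl (suc k)

  -- From the finite checks to ultrahomogeneity.

  module _ (Γ : List (Aut G)) (b : Vec (Fin n) 6)
           (transitive : Transitive Γ b) (pencils : Pencils) where

    -- The tabulated `f` occurs in the enumeration from its own vertex `f 0F`, and `transitive`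
    -- places that whole list in the orbit of `b`.
    reach : ∀ f → IsEmbedding C⃗₆ G f → ∃[ σ ] act {G = G} σ ∘ lookup b ≗ f
    reach f e = σ , λ i → trans (sym (lookup-map i (act {G = G} σ) b))
                        (trans (cong (λ x → lookup x i) (sym eq)) (lookup∘tabulate f i))
      where
      found = ∈-map⁻ (λ σ → Vec.map (act {G = G} σ) b)
        (All.lookup (transitive (f 0F)) (∈-hexagonsFrom e))
      σ = proj₁ found
      eq = proj₂ (proj₂ found)

    pencilThrough : ∀ {u v w} → Edge G u v → Edge G v w → u ≢ w → Pencil (hexagonsThrough u v w)
    pencilThrough {u} {v} {w} uv vw = All.lookup
      (All.lookup (pencils u) (from⇔ (∈-neighbours u v) uv)) (from⇔ (∈-neighbours v w) vw)

    C⃗₆-UH : UH C⃗₆ G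
    C⃗₆-UH = UH-fromOrbit {H = C⃗₆} full (lookup b) reach

    P⃗₃-UH : UH P⃗₃ G
    P⃗₃-UH = UH-fromOrbit {H = P⃗₃} full (lookup b ∘ start) reach₃
      where
      reach₃ : ∀ p → IsEmbedding P⃗₃ G p → ∃[ σ ] act {G = G} σ ∘ lookup b ∘ start ≗ p
      reach₃ p e = σ , λ k → trans (σb≗x (start k)) (x≗p k)
        where
        some = pencil-nonempty (pencilThrough (edge e {0F} {1F} refl) (edge e {1F} {2F} refl)
          (λ eq → contradiction (injective e 0F 2F eq) λ ()))
        x = proj₁ some
        hexagon-x = proj₁ (∈-hexagonsThrough⁻ p (proj₂ some))
        x≗p = proj₂ (∈-hexagonsThrough⁻ p (proj₂ some))
        reached = reach (lookup x) hexagon-x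
        σ = proj₁ reached
        σb≗x = proj₂ reached

    -- The list of hexagons through the first three vertices of `h` contains `h` itself, and its
    -- other entry is the companion. Any `g` with the same beginning is in that list too, which
    -- gives `only`.
    companion : ∀ h → IsEmbedding C⃗₆ G h → ∃ (Companion G h)
    companion h e = y , record
      { isEmbedding = proj₁ y-through
      ; start≗      = proj₂ y-through
      ; meet        = λ i j eq → proj₁ (proj₂ (proj₂ other)) i j (trans (lookup∘tabulate h i) eq)
      ; only        = λ g e′ g≗h → Sum.map (unfold-≗ g h) (unfold-≗′ g) (proj₂ (proj₂ (proj₂ other))
                        (∈-hexagonsThrough e′ (g≗h 0F) (g≗h 1F) (g≗h 2F)))
      }
      where
      other = pencil-other
        (pencilThrough (edge e {0F} {1F} refl) (edge e {1F} {2F} refl)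
          (λ eq → contradiction (injective e 0F 2F eq) λ ()))
        (∈-hexagonsThrough e refl refl refl)
      y = lookup (proj₁ other)
      y-through = ∈-hexagonsThrough⁻ (h ∘ start) (proj₁ (proj₂ other))
      unfold-≗′ : ∀ g {x} → tabulate g ≡ x → g ≗ lookup x
      unfold-≗′ g refl i = sym (lookup∘tabulate g i)
      unfold-≗ : ∀ g h → tabulate g ≡ tabulate h → g ≗ h
      unfold-≗ g h eq i = trans (unfold-≗′ g eq i) (lookup∘tabulate h i)

    isUltrahomogeneous : SubscriptUH C⃗₆ P⃗₃ G × SuperscriptUH C⃗₆ P⃗₃ G
    isUltrahomogeneous =
      (P⃗₃-UH , C⃗₆-UH , reverse-uniqueNeighbour {G = G} (companions⇒uniqueNeighbour companion)) ,
      (P⃗₃-UH , C⃗₆-UH , companions⇒uniqueNeighbour companion)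

-- Neighbour lists, symmetries and base hexagons of the two graphs.

-- LCF notation: u is joined to u ± 1 and to u + c, where c is the entry of the
-- code at u modulo the length of the code.
lcf : ∀ n .{{_ : ℕ.NonZero n}} {k} .{{_ : ℕ.NonZero k}} → Vec ℕ k → Fin n → List (Fin n)
lcf n {k} code u =
  (toℕ u ℕ.+ 1) mod n ∷ (toℕ u ℕ.+ ℕ.pred n) mod n ∷
  (toℕ u ℕ.+ lookup code (toℕ u mod k)) mod n ∷ []

pappusEdge? : Decidable PappusEdge
pappusEdge? u v = map′
  (λ { (inj₁ refl) → cycle u
     ; (inj₂ (inj₁ (x , refl , refl))) → chord₁ x
     ; (inj₂ (inj₂ (inj₁ (x , refl , refl)))) → chord₂ x
     ; (inj₂ (inj₂ (inj₂ (x , refl , refl)))) → chord₃ x })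
  (λ { (cycle _)  → inj₁ refl
     ; (chord₁ x) → inj₂ (inj₁ (x , refl , refl))
     ; (chord₂ x) → inj₂ (inj₂ (inj₁ (x , refl , refl)))
     ; (chord₃ x) → inj₂ (inj₂ (inj₂ (x , refl , refl))) })
  ((suc (toℕ u) mod 18 ≟ v) ⊎-dec chord 1 6 ⊎-dec chord 2 9 ⊎-dec chord 4 11)
  where
  chord : ∀ a b → Dec (∃ λ (x : Fin 3) →
            (a ℕ.+ 6 ℕ.* toℕ x) mod 18 ≡ u × (b ℕ.+ 6 ℕ.* toℕ x) mod 18 ≡ v)
  chord a b = any? λ x →
    ((a ℕ.+ 6 ℕ.* toℕ x) mod 18 ≟ u) ×-dec ((b ℕ.+ 6 ℕ.* toℕ x) mod 18 ≟ v)

desarguesEdge? : Decidable DesarguesEdge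
desarguesEdge? u v = map′
  (λ { (inj₁ refl) → cycle u
     ; (inj₂ (inj₁ (x , refl , refl))) → chord₁ x
     ; (inj₂ (inj₂ (x , refl , refl))) → chord₂ x })
  (λ { (cycle _)  → inj₁ refl
     ; (chord₁ x) → inj₂ (inj₁ (x , refl , refl))
     ; (chord₂ x) → inj₂ (inj₂ (x , refl , refl)) })
  ((suc (toℕ u) mod 20 ≟ v) ⊎-dec chord 3F 0F ⊎-dec chord 1F 2F)
  where
  chord : ∀ i j → Dec (∃ λ x → x ⟨ i ⟩ ≡ u × (x +2) ⟨ j ⟩ ≡ v)
  chord i j = any? λ x → (x ⟨ i ⟩ ≟ u) ×-dec ((x +2) ⟨ j ⟩ ≟ v)

-- The code [-5, 5, 7, -7, 7, -7], repeated three times, with entries reduced modulo 18.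
pappusNeighbours : Fin 18 → List (Fin 18)
pappusNeighbours = lcf 18 (13 ∷ 5 ∷ 7 ∷ 11 ∷ 7 ∷ 11 ∷ [])

-- The code [-5, 9, -9, 5], repeated five times, with entries reduced modulo 20.
desarguesNeighbours : Fin 20 → List (Fin 20)
desarguesNeighbours = lcf 20 (15 ∷ 9 ∷ 11 ∷ 5 ∷ [])

private
  module P = Hexagons Pappus pappusNeighbours (from-yes (all? λ u → all? λ v →
    (v ∈? pappusNeighbours u) ⇔-dec symClosure? pappusEdge? u v))

  module D = Hexagons Desargues desarguesNeighbours (from-yes (all? λ u → all? λ v →
    (v ∈? desarguesNeighbours u) ⇔-dec symClosure? desarguesEdge? u v))

-- Each group is a product of three cyclic subgroups, of orders 12, 6, 3 for
-- Pappus and 6, 4, 10 for Desargues; the tables list the images of 0, 1, 2, ….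
pappusSymmetries : List (Aut Pappus)
pappusSymmetries = cartesianProductWith ≅-trans (cartesianProductWith ≅-trans
  (P.powers (# 13 ∷ # 14 ∷ # 3 ∷ # 4 ∷ # 5 ∷ # 16 ∷ # 15 ∷ # 8 ∷ # 9 ∷
    # 2 ∷ # 1 ∷ # 6 ∷ # 7 ∷ # 12 ∷ # 11 ∷ # 10 ∷ # 17 ∷ # 0 ∷ []) 11)
  (P.powers (# 10 ∷ # 9 ∷ # 2 ∷ # 1 ∷ # 6 ∷ # 7 ∷ # 8 ∷ # 15 ∷ # 14 ∷
    # 3 ∷ # 4 ∷ # 5 ∷ # 16 ∷ # 17 ∷ # 0 ∷ # 13 ∷ # 12 ∷ # 11 ∷ []) 5))
  (P.powers (# 12 ∷ # 13 ∷ # 14 ∷ # 15 ∷ # 16 ∷ # 17 ∷ # 0 ∷ # 1 ∷ # 2 ∷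
    # 3 ∷ # 4 ∷ # 5 ∷ # 6 ∷ # 7 ∷ # 8 ∷ # 9 ∷ # 10 ∷ # 11 ∷ []) 2)

desarguesSymmetries : List (Aut Desargues)
desarguesSymmetries = cartesianProductWith ≅-trans (cartesianProductWith ≅-trans
  (D.powers (# 6 ∷ # 5 ∷ # 14 ∷ # 15 ∷ # 16 ∷ # 11 ∷ # 10 ∷ # 1 ∷ # 0 ∷
    # 19 ∷ # 4 ∷ # 3 ∷ # 2 ∷ # 13 ∷ # 12 ∷ # 7 ∷ # 8 ∷ # 9 ∷ # 18 ∷ # 17 ∷ []) 5)
  (D.powers (# 13 ∷ # 12 ∷ # 7 ∷ # 6 ∷ # 5 ∷ # 4 ∷ # 19 ∷ # 18 ∷ # 17 ∷
    # 16 ∷ # 11 ∷ # 10 ∷ # 9 ∷ # 8 ∷ # 3 ∷ # 2 ∷ # 1 ∷ # 0 ∷ # 15 ∷ # 14 ∷ []) 3))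
  (D.powers (# 1 ∷ # 10 ∷ # 11 ∷ # 12 ∷ # 13 ∷ # 14 ∷ # 5 ∷ # 6 ∷ # 7 ∷
    # 8 ∷ # 9 ∷ # 18 ∷ # 17 ∷ # 16 ∷ # 15 ∷ # 0 ∷ # 19 ∷ # 4 ∷ # 3 ∷ # 2 ∷ []) 9)

-- Five consecutive edges of the 18-cycle, closed by the chord joining 1 and 6.
pappusHexagon : Vec (Fin 18) 6
pappusHexagon = # 1 ∷ # 2 ∷ # 3 ∷ # 4 ∷ # 5 ∷ # 6 ∷ []

-- Five consecutive edges of the 20-cycle, closed by the chord joining 3 and 8, that is, 0₃ and 2₀.
desarguesHexagon : Vec (Fin 20) 6
desarguesHexagon = # 3 ∷ # 4 ∷ # 5 ∷ # 6 ∷ # 7 ∷ # 8 ∷ []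

pappusTransitive : P.Transitive pappusSymmetries pappusHexagon
pappusTransitive = from-yes (P.transitive? pappusSymmetries pappusHexagon)

desarguesTransitive : D.Transitive desarguesSymmetries desarguesHexagon
desarguesTransitive = from-yes (D.transitive? desarguesSymmetries desarguesHexagon)

theorem2 : SubscriptUH C⃗₆ P⃗₃ Desargues × SuperscriptUH C⃗₆ P⃗₃ Pappus
theorem2 =
  -- Each graph satisfies both variants; one is selected for each.
  proj₁ (D.isUltrahomogeneous desarguesSymmetries desarguesHexagon
    desarguesTransitive (from-yes D.pencils?)) ,
  proj₂ (P.isUltrahomogeneous pappusSymmetries pappusHexagon
    pappusTransitive (from-yes P.pencils?))
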